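{- A hypergraph ${\cal H}$ is $1$-Sperner if and only if either it has no vertices (that is, ${\cal H}\in\{(\emptyset,\emptyset),(\emptyset,\{\emptyset\})\}$) or it is a safe gluing of two $1$-Sperner hypergraphs each with fewer vertices than ${\cal H}$.
   Context: A hypergraph ${\cal H}=(V,{\cal E})$ consists of a finite vertex set $V$ and a set ${\cal E}$ of subsets of $V$. It is $1$-Sperner if every two distinct hyperedges $e,f$ satisfy $\min\{|e\setminus f|,|f\setminus e|\}=1$. Given vertex-disjoint hypergraphs ${\cal H}_1=(V_1,{\cal E}_1)$, ${\cal H}_2=(V_2,{\cal E}_2)$ and a new vertex $z\notin V_1\cup V_2$, the gluing ${\cal H}_1\odot{\cal H}_2$ has vertex set $V_1\cup V_2\cup\{z\}$ and hyperedge set $\{\{z\}\cup e: e\in{\cal E}_1\}\cup\{V_1\cup e: e\in{\cal E}_2\}$. A gluing is safe if it results in a $1$-Sperner hypergraph; for $1$-Sperner ${\cal H}_1,{\cal H}_2$ this is equivalent to ${\cal E}_1\neq\{V_1\}$ or ${\cal E}_2\neq\{\emptyset\}$. -}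

module Defs where

open import Data.Fin.Base using (Fin)
open import Data.Fin.Subset
  using (Subset; _∉_; _⊆_; _∪_; _∩_; _─_; ∣_∣; ⁅_⁆; ⊥; Empty)
open import Data.Fin.Subset.Properties
  using (anySubset?; ⊆-refl; ⊆-trans; p⊆p∪q; q⊆p∪q; x∈p∪q⁻)
open import Data.Bool.Properties using () renaming (_≟_ to _≟ᵇ_)
open import Data.Nat.Base using (ℕ; _⊓_)
open import Data.Product.Base using (∃-syntax; _×_; _,_)
open import Data.Sum.Base using (_⊎_; inj₁; inj₂)
open import Data.Vec.Properties using (≡-dec)
open import Level using (0ℓ)
open import Relation.Binary.Definitions using (DecidableEquality)
open import Relation.Binary.PropositionalEquality using (_≡_; _≢_; refl)
open import Relation.Nullary.Decidable using (_×-dec_; _⊎-dec_)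
open import Relation.Unary using (Pred; Decidable; _≐_; ∅; ｛_｝)
open import Relation.Unary.Properties using (∅?)

-- All hypergraphs under discussion have their vertices in a common finite
-- ambient set Fin n; the vertex set V is an arbitrary subset of it.  This
-- lets vertex-disjointness, z ∉ V₁ ∪ V₂ and the gluing be taken literally
-- instead of up to isomorphism.  Decidability of E is what makes E a
-- finite set of hyperedges constructively.
record Hypergraph (n : ℕ) : Set₁ where
  field
    V   : Subset n
    E   : Pred (Subset n) 0ℓ
    E?  : Decidable E
    E⊆V : ∀ {e} → E e → e ⊆ V

open Hypergraph public

private
  variable
    n : ℕ

_≟ˢ_ : DecidableEquality (Subset n)
_≟ˢ_ = ≡-dec _≟ᵇ_

-- Equality of hypergraphs: same vertex set and same set of hyperedges.
infix 4 _≋_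

_≋_ : Hypergraph n → Hypergraph n → Set
H ≋ K = V H ≡ V K × E H ≐ E K

NoVertices : Hypergraph n → Set
NoVertices H = Empty (V H)

⟨∅,∅⟩ : Hypergraph n
⟨∅,∅⟩ = record { V = ⊥ ; E = ∅ ; E? = ∅? ; E⊆V = λ () }

⟨∅,｛∅｝⟩ : Hypergraph n
⟨∅,｛∅｝⟩ = record
  { V   = ⊥
  ; E   = ｛ ⊥ ｝
  ; E?  = ⊥ ≟ˢ_
  ; E⊆V = λ { refl → ⊆-refl }
  }

1-Sperner : Hypergraph n → Set
1-Sperner H = ∀ {e f} → E H e → E H f → e ≢ f → ∣ e ─ f ∣ ⊓ ∣ f ─ e ∣ ≡ 1

-- The operation is total; the disjointness conditions under which it is a
-- gluing are collected in IsGluing.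
glue : Fin n → Hypergraph n → Hypergraph n → Hypergraph n
glue z H₁ H₂ = record
  { V   = W
  ; E   = λ g → (∃[ e ] E H₁ e × g ≡ ⁅ z ⁆ ∪ e)
              ⊎ (∃[ e ] E H₂ e × g ≡ V H₁ ∪ e)
  ; E?  = λ g → anySubset? (λ e → E? H₁ e ×-dec (g ≟ˢ (⁅ z ⁆ ∪ e)))
         ⊎-dec anySubset? (λ e → E? H₂ e ×-dec (g ≟ˢ (V H₁ ∪ e)))
  ; E⊆V = λ
      { (inj₁ (e , e∈E₁ , refl)) →
          ∪-lub (q⊆p∪q (V H₁ ∪ V H₂) ⁅ z ⁆)
                (⊆-trans (E⊆V H₁ e∈E₁) V₁⊆W)
      ; (inj₂ (e , e∈E₂ , refl)) →
          ∪-lub V₁⊆W (⊆-trans (E⊆V H₂ e∈E₂) V₂⊆W)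
      }
  }
  where
  W : Subset _
  W = (V H₁ ∪ V H₂) ∪ ⁅ z ⁆

  V₁⊆W : V H₁ ⊆ W
  V₁⊆W = ⊆-trans (p⊆p∪q (V H₂)) (p⊆p∪q ⁅ z ⁆)

  V₂⊆W : V H₂ ⊆ W
  V₂⊆W = ⊆-trans (q⊆p∪q (V H₁) (V H₂)) (p⊆p∪q ⁅ z ⁆)

  ∪-lub : ∀ {p q r : Subset n} → p ⊆ r → q ⊆ r → p ∪ q ⊆ r
  ∪-lub {p = p} {q} p⊆r q⊆r x∈p∪q with x∈p∪q⁻ p q x∈p∪q
  ... | inj₁ x∈p = p⊆r x∈p
  ... | inj₂ x∈q = q⊆r x∈q

record IsGluing (z : Fin n) (H₁ H₂ H : Hypergraph n) : Set where
  field
    disjoint : Empty (V H₁ ∩ V H₂)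
    z-new    : z ∉ V H₁ ∪ V H₂
    glued    : H ≋ glue z H₁ H₂

IsSafeGluing : (H₁ H₂ H : Hypergraph n) → Set
IsSafeGluing H₁ H₂ H =
  ∃[ z ] IsGluing z H₁ H₂ H × 1-Sperner (glue z H₁ H₂)

{-# OPTIONS --safe #-}
-- A 1-Sperner hypergraph H decomposes at z as soon as e ∖ {z} ⊆ f whenever z
-- lies in the hyperedge e and not in f: take for V₁ the union of the hyperedges
-- through z, minus z, and for V₂ the remaining vertices.  Such a z is found as
-- follows.  Say that z dominates x if, for every hyperedge f containing x but
-- not z, the set f ∖ {x} ∪ {z} contains a hyperedge.  Domination is transitive,
-- and by the 1-Sperner property it is total, so some vertex z dominates all
-- others.  If e ∋ z and f ∌ z had a further w ∈ e ∖ f, then f ∖ e = {x} for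
-- some x, and a hyperedge inside f ∖ {x} ∪ {z} would be a proper subset of e.
module Submission where

open import Defs
open import Data.Empty using (⊥-elim)
open import Data.Fin.Base using (Fin; zero; suc)
open import Data.Fin.Properties using (_≟_)
open import Data.Fin.Subset
  using (Subset; inside; outside; _∈_; _∉_; _⊆_; _∪_; _─_; _-_; ∣_∣; ⁅_⁆; ⊥; Empty; Nonempty)
open import Data.Fin.Subset.Properties
open import Data.Bool.Base using (true)
open import Data.Nat.Base using (ℕ; _<_; _⊓_)
open import Data.Nat.Properties using (⊓-sel; 0≢1+n; 1+n≢0; suc-injective)
open import Data.Product.Base using (_×_; ∃-syntax; _,_; proj₁; proj₂)
open import Data.Sum.Base using (_⊎_; inj₁; inj₂; [_,_]′)
open import Data.Vec.Base using (_∷_; tabulate; here; there)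
open import Data.Vec.Properties using ([]=⇒lookup; lookup⇒[]=; lookup∘tabulate)
open import Function.Base using (_∘_; id)
open import Function.Bundles using (_⇔_; mk⇔)
open import Level using (Level)
open import Relation.Binary.Core using (Rel)
open import Relation.Binary.Definitions using (Total; Transitive)
open import Relation.Binary.PropositionalEquality
  using (_≡_; _≢_; refl; sym; trans; cong; cong₂; subst; module ≡-Reasoning)
open import Relation.Nullary.Decidable
  using (Dec; yes; no; does; dec-true; ¬?; _×-dec_; decidable-stable)
open import Relation.Nullary.Negation using (¬_; contradiction)
open import Relation.Unary using (Pred; Decidable; _≐_)

private
  variable
    ℓ : Level
    n : ℕ
    x y z : Fin n
    p q r : Subset n

-- Finite subsets: comprehension, differences, cardinality one

comprehension : {P : Pred (Fin n) ℓ} → Decidable P → Subset n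
comprehension P? = tabulate (does ∘ P?)

module _ {P : Pred (Fin n) ℓ} (P? : Decidable P) where

  ∈-comprehension⁺ : P x → x ∈ comprehension P?
  ∈-comprehension⁺ {x} Px =
    lookup⇒[]= x _ (trans (lookup∘tabulate (does ∘ P?) x) (dec-true (P? x) Px))

  ∈-comprehension⁻ : x ∈ comprehension P? → P x
  ∈-comprehension⁻ {x} x∈ = decode (P? x) (trans (sym (lookup∘tabulate (does ∘ P?) x)) ([]=⇒lookup x∈))
    where
    -- Only a positive decision can occur: a negative one would turn the equation into false ≡ true.
    decode : (d : Dec (P x)) → does d ≡ true → P x
    decode (yes Px) _ = Px

x∈p─q⇒x∉q : ∀ (p q : Subset n) → x ∈ p ─ q → x ∉ q
x∈p─q⇒x∉q (_ ∷ p) (_ ∷ q) (there x∈p─q) (there x∈q) = x∈p─q⇒x∉q p q x∈p─q x∈q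

x∈p-y⇒x≢y : ∀ (p : Subset n) y → x ∈ p - y → x ≢ y
x∈p-y⇒x≢y p y x∈p-y refl = x∈p─q⇒x∉q p ⁅ y ⁆ x∈p-y (x∈⁅x⁆ y)

p⊆q⇒p─q≡⊥ : p ⊆ q → p ─ q ≡ ⊥
p⊆q⇒p─q≡⊥ {p = p} {q} p⊆q =
  Empty-unique λ (_ , x∈p─q) → x∈p─q⇒x∉q p q x∈p─q (p⊆q (p─q⊆p p q x∈p─q))

∣p∣≡0⇒Empty : ∀ (p : Subset n) → ∣ p ∣ ≡ 0 → Empty p
∣p∣≡0⇒Empty (outside ∷ p) ∣p∣≡0 (suc x , there x∈p) = ∣p∣≡0⇒Empty p ∣p∣≡0 (x , x∈p)

∣p∣≡1⇒unique : ∀ (p : Subset n) → ∣ p ∣ ≡ 1 → x ∈ p → y ∈ p → x ≡ y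
∣p∣≡1⇒unique p             ∣p∣≡1 here        here        = refl
∣p∣≡1⇒unique (inside  ∷ p) ∣p∣≡1 here        (there y∈p) =
  contradiction (_ , y∈p) (∣p∣≡0⇒Empty p (suc-injective ∣p∣≡1))
∣p∣≡1⇒unique (inside  ∷ p) ∣p∣≡1 (there x∈p) _           =
  contradiction (_ , x∈p) (∣p∣≡0⇒Empty p (suc-injective ∣p∣≡1))
∣p∣≡1⇒unique (outside ∷ p) ∣p∣≡1 (there x∈p) (there y∈p) =
  cong suc (∣p∣≡1⇒unique p ∣p∣≡1 x∈p y∈p)

∣p∣≡1⇒Nonempty : ∀ {n} (p : Subset n) → ∣ p ∣ ≡ 1 → Nonempty p
∣p∣≡1⇒Nonempty {n} p ∣p∣≡1 with nonempty? p
... | yes ne = ne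
... | no ¬ne = contradiction
  (trans (sym ∣p∣≡1) (trans (cong ∣_∣ (Empty-unique ¬ne)) (∣⊥∣≡0 n))) 1+n≢0

∪-⊆ : p ⊆ r → q ⊆ r → p ∪ q ⊆ r
∪-⊆ {p = p} {q = q} p⊆r q⊆r = [ p⊆r , q⊆r ]′ ∘ x∈p∪q⁻ p q

p⊆q⇒p∪[q─p]≡q : p ⊆ q → p ∪ (q ─ p) ≡ q
p⊆q⇒p∪[q─p]≡q {p = p} {q} p⊆q = ⊆-antisym (∪-⊆ p⊆q (p─q⊆p q p)) q⊆
  where
  q⊆ : q ⊆ p ∪ (q ─ p)
  q⊆ {x} x∈q with x ∈? p
  ... | yes x∈p = x∈p∪q⁺ (inj₁ x∈p)
  ... | no  x∉p = x∈p∪q⁺ (inj₂ (x∈p∧x∉q⇒x∈p─q x∈q x∉p))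

-- The subtrahend removes all of `r`, and disjointness keeps it from removing more of `p` than `q`
-- does. Hence a common disjoint prefix does not affect the differences that define 1-Sperner.
[r∪p]─[r∪q]≡p─q : (∀ {x} → x ∈ r → x ∉ p) → (r ∪ p) ─ (r ∪ q) ≡ p ─ q
[r∪p]─[r∪q]≡p─q {r = r} {p} {q} r∩p=∅ = ⊆-antisym ⇒ ⇐
  where
  ⇒ : (r ∪ p) ─ (r ∪ q) ⊆ p ─ q
  ⇒ x∈ with x∈p─q⇒x∉q (r ∪ p) (r ∪ q) x∈ | x∈p∪q⁻ r p (p─q⊆p (r ∪ p) (r ∪ q) x∈)
  ... | x∉r∪q | inj₁ x∈r = contradiction (x∈p∪q⁺ (inj₁ x∈r)) x∉r∪q
  ... | x∉r∪q | inj₂ x∈p = x∈p∧x∉q⇒x∈p─q x∈p (x∉r∪q ∘ x∈p∪q⁺ ∘ inj₂)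

  ⇐ : p ─ q ⊆ (r ∪ p) ─ (r ∪ q)
  ⇐ x∈ = x∈p∧x∉q⇒x∈p─q (x∈p∪q⁺ (inj₂ x∈p))
    ([ (λ x∈r → r∩p=∅ x∈r x∈p) , x∈p─q⇒x∉q p q x∈ ]′ ∘ x∈p∪q⁻ r q)
    where x∈p = p─q⊆p p q x∈

∪-cancelˡ-⊆ : (∀ {x} → x ∈ r → x ∉ p) → r ∪ p ⊆ r ∪ q → p ⊆ q
∪-cancelˡ-⊆ {r = r} {q = q} r∩p=∅ r∪p⊆r∪q x∈p with x∈p∪q⁻ r q (r∪p⊆r∪q (x∈p∪q⁺ (inj₂ x∈p)))
... | inj₁ x∈r = contradiction x∈p (r∩p=∅ x∈r)
... | inj₂ x∈q = x∈q

-- Induction on the ambient size: a greatest element of the tail is compared with the head, and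
-- transitivity extends a win of the head to the whole tail.
greatest : {_≽_ : Rel (Fin n) ℓ} → Total _≽_ → Transitive _≽_ →
           ∀ (p : Subset n) → Nonempty p → ∃[ z ] z ∈ p × (∀ {x} → x ∈ p → z ≽ x)
greatest total tr (s ∷ p) ne
  with nonempty? p
greatest total tr (outside ∷ p) (_ , there x∈p) | no ¬ne = contradiction (_ , x∈p) ¬ne
-- Reflexivity comes from totality at equal arguments.
greatest total tr (inside  ∷ p) _               | no ¬ne =
  zero , here , λ { here        → [ id , id ]′ (total zero zero)
                  ; (there x∈p) → contradiction (_ , x∈p) ¬ne }
greatest total tr (s ∷ p) _ | yes ne
  with z , z∈p , z≽ ← greatest (λ x y → total (suc x) (suc y)) tr p ne | s
... | outside = suc z , there z∈p , λ { (there x∈p) → z≽ x∈p }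
... | inside with total zero (suc z)
...   | inj₁ 0≽z = zero , here ,
          λ { here        → [ id , id ]′ (total zero zero)
            ; (there x∈p) → tr 0≽z (z≽ x∈p) }
...   | inj₂ z≽0 = suc z , there z∈p , λ { here → z≽0 ; (there x∈p) → z≽ x∈p }

-- Exchanging one vertex for another

_[_↦_] : Subset n → Fin n → Fin n → Subset n
p [ x ↦ z ] = (p - x) ∪ ⁅ z ⁆

∈-↦⁻ : y ∈ p [ x ↦ z ] → y ≡ z ⊎ (y ∈ p × y ≢ x)
∈-↦⁻ {p = p} {x} {z} y∈ with x∈p∪q⁻ (p - x) ⁅ z ⁆ y∈
... | inj₁ y∈p-x = inj₂ (p─q⊆p p ⁅ x ⁆ y∈p-x , x∈p-y⇒x≢y p x y∈p-x)
... | inj₂ y∈⁅z⁆ = inj₁ (x∈⁅y⁆⇒x≡y z y∈⁅z⁆)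

∈-↦⁺ : y ≡ z ⊎ (y ∈ p × y ≢ x) → y ∈ p [ x ↦ z ]
∈-↦⁺ {z = z} (inj₁ refl)        = x∈p∪q⁺ (inj₂ (x∈⁅x⁆ z))
∈-↦⁺         (inj₂ (y∈p , y≢x)) = x∈p∪q⁺ (inj₁ (x∈p∧x≢y⇒x∈p-y y∈p y≢x))

-- The vertex `x` is all that `p` has outside `q`, and removing `z` from `q` costs `p` nothing.
∣p─q∣≡1⇒p⊆q[↦] : ∀ (p q : Subset n) → ∣ p ─ q ∣ ≡ 1 → x ∈ p → x ∉ q → z ∉ p → p ⊆ q [ z ↦ x ]
∣p─q∣≡1⇒p⊆q[↦] p q ∣p─q∣≡1 x∈p x∉q z∉p {v} v∈p with v ∈? q
... | yes v∈q = ∈-↦⁺ (inj₂ (v∈q , λ { refl → z∉p v∈p }))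
... | no  v∉q = ∈-↦⁺ (inj₁ (∣p∣≡1⇒unique _ ∣p─q∣≡1 (x∈p∧x∉q⇒x∈p─q v∈p v∉q) (x∈p∧x∉q⇒x∈p─q x∈p x∉q)))

-- Domination between vertices

module _ (H : Hypergraph n) where

  ContainsEdge : Subset n → Set
  ContainsEdge p = ∃[ g ] E H g × g ⊆ p

  containsEdge? : Decidable ContainsEdge
  containsEdge? p = anySubset? λ g → E? H g ×-dec g ⊆? p

  Dominates : Fin n → Fin n → Set
  Dominates z x = ∀ {f} → E H f → x ∈ f → z ∉ f → ContainsEdge (f [ x ↦ z ])

  -- A failure of domination with an explicit witness. It is decidable by finite search, so totality
  -- can be proved by comparing two witnesses.
  Undominated : Fin n → Fin n → Set
  Undominated z x = ∃[ f ] E H f × x ∈ f × z ∉ f × ¬ ContainsEdge (f [ x ↦ z ])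

  undominated? : ∀ z x → Dec (Undominated z x)
  undominated? z x = anySubset? λ f →
    E? H f ×-dec x ∈? f ×-dec ¬? (z ∈? f) ×-dec ¬? (containsEdge? (f [ x ↦ z ]))

  dominates : ¬ Undominated z x → Dominates z x
  dominates ¬und {f} f∈E x∈f z∉f = decidable-stable (containsEdge? _)
    λ ¬ce → ¬und (f , f∈E , x∈f , z∉f , ¬ce)

  -- Extends domination from hyperedges to any set containing one: a contained hyperedge that avoids
  -- `x` survives the exchange, and one through `x` is itself exchanged.
  replace : Dominates z x → x ∈ p → z ∉ p → ContainsEdge p → ContainsEdge (p [ x ↦ z ])
  replace {z} {x} {p} z≽x x∈p z∉p (g , g∈E , g⊆p) with x ∈? g
  ... | no x∉g = g , g∈E , λ v∈g → ∈-↦⁺ (inj₂ (g⊆p v∈g , λ { refl → x∉g v∈g }))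
  ... | yes x∈g with h , h∈E , h⊆ ← z≽x g∈E x∈g (z∉p ∘ g⊆p) =
    h , h∈E , ∈-↦⁺ ∘ [ inj₁ , (λ (v∈g , v≢x) → inj₂ (g⊆p v∈g , v≢x)) ]′ ∘ ∈-↦⁻ ∘ h⊆

  -- Two exchanges compose to the exchange of `y` for `z`. Their order depends on whether `x ∈ f`,
  -- since the incoming vertex must lie outside the current set.
  dominates-trans : Transitive Dominates
  dominates-trans {z} {x} {y} z≽x x≽y {f} f∈E y∈f z∉f with x ∈? f | z ≟ x
  ... | no x∉f  | yes refl = x≽y f∈E y∈f x∉f
  -- First `x` takes the place of `y`, then `z` that of `x`.
  ... | no x∉f  | no  z≢x
    with h , h∈E , h⊆ ← replace z≽x (∈-↦⁺ (inj₁ refl))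
                          ([ z≢x , z∉f ∘ proj₁ ]′ ∘ ∈-↦⁻) (x≽y f∈E y∈f x∉f)
    = h , h∈E , ∈-↦⁺ ∘ [ inj₁ , (λ (v∈ , v≢x) → [ (λ v≡x → contradiction v≡x v≢x) , inj₂ ]′ (∈-↦⁻ v∈)) ]′
                ∘ ∈-↦⁻ ∘ h⊆
  ... | yes x∈f | yes refl = contradiction x∈f z∉f
  ... | yes x∈f | no  z≢x with y ≟ x
  ...   | yes refl = z≽x f∈E x∈f z∉f
  -- First `z` takes the place of `x`, then `x` returns in place of `y`.
  ...   | no y≢x
    with h , h∈E , h⊆ ← replace x≽y (∈-↦⁺ (inj₂ (y∈f , y≢x)))
                          ([ z≢x ∘ sym , (λ (_ , x≢x) → x≢x refl) ]′ ∘ ∈-↦⁻) (z≽x f∈E x∈f z∉f)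
    = h , h∈E , ∈-↦⁺ ∘ [ (λ { refl → inj₂ (x∈f , y≢x ∘ sym) })
                       , (λ (v∈ , v≢y) → [ inj₁ , (λ (v∈f , _) → inj₂ (v∈f , v≢y)) ]′ (∈-↦⁻ v∈)) ]′
                ∘ ∈-↦⁻ ∘ h⊆

  module _ (sperner : 1-Sperner H) where

    one-difference-singleton : ∀ {e f} → E H e → E H f → e ≢ f → ∣ e ─ f ∣ ≡ 1 ⊎ ∣ f ─ e ∣ ≡ 1
    one-difference-singleton {e} {f} e∈E f∈E e≢f with ⊓-sel ∣ e ─ f ∣ ∣ f ─ e ∣
    ... | inj₁ min≡ = inj₁ (trans (sym min≡) (sperner e∈E f∈E e≢f))
    ... | inj₂ min≡ = inj₂ (trans (sym min≡) (sperner e∈E f∈E e≢f))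

    -- An inclusion makes one of the two differences empty, so for distinct hyperedges the minimum
    -- would be 0 instead of 1.
    ⊆⇒≡ : ∀ {e f} → E H e → E H f → e ⊆ f → e ≡ f
    ⊆⇒≡ {e} {f} e∈E f∈E e⊆f = decidable-stable (e ≟ˢ f) λ e≢f → 0≢1+n (begin
      0                       ≡⟨ cong (_⊓ ∣ f ─ e ∣) (trans (cong ∣_∣ (p⊆q⇒p─q≡⊥ e⊆f)) (∣⊥∣≡0 n)) ⟨
      ∣ e ─ f ∣ ⊓ ∣ f ─ e ∣   ≡⟨ sperner e∈E f∈E e≢f ⟩
      1                       ∎)
      where open ≡-Reasoning

    dominates-total : Total Dominates
    dominates-total z x with undominated? z x | undominated? x z
    ... | no ¬und | _       = inj₁ (dominates ¬und)
    ... | yes _   | no ¬und = inj₂ (dominates ¬und)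
    ... | yes (f , f∈E , x∈f , z∉f , ¬f↦) | yes (g , g∈E , z∈g , x∉g , ¬g↦)
      with one-difference-singleton f∈E g∈E (λ { refl → x∉g x∈f })
    -- Here `x` is the only vertex of `f` outside `g`, so `f` itself is a hyperedge inside
    -- `g [ z ↦ x ]`. The other case is symmetric.
    ...   | inj₁ ∣f─g∣≡1 = ⊥-elim (¬g↦ (f , f∈E , ∣p─q∣≡1⇒p⊆q[↦] f g ∣f─g∣≡1 x∈f x∉g z∉f))
    ...   | inj₂ ∣g─f∣≡1 = ⊥-elim (¬f↦ (g , g∈E , ∣p─q∣≡1⇒p⊆q[↦] g f ∣g─f∣≡1 z∈g z∉f x∉g))

    dominating⇒splits : (∀ {x} → x ∈ V H → Dominates z x) →
      ∀ {e f} → E H e → E H f → z ∈ e → z ∉ f → e - z ⊆ f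
    dominating⇒splits {z} z≽ {e} {f} e∈E f∈E z∈e z∉f {w} w∈e-z = decidable-stable (w ∈? f) absurd
      where
      w∈e : w ∈ e
      w∈e = p─q⊆p e ⁅ z ⁆ w∈e-z

      w≢z : w ≢ z
      w≢z = x∈p-y⇒x≢y e z w∈e-z

      absurd : ¬ w ∉ f
      absurd w∉f with one-difference-singleton e∈E f∈E (λ { refl → z∉f z∈e })
      ... | inj₁ ∣e─f∣≡1 = w≢z (∣p∣≡1⇒unique _ ∣e─f∣≡1 (x∈p∧x∉q⇒x∈p─q w∈e w∉f) (x∈p∧x∉q⇒x∈p─q z∈e z∉f))
      ... | inj₂ ∣f─e∣≡1
        with x , x∈f─e ← ∣p∣≡1⇒Nonempty _ ∣f─e∣≡1
        with x∈f ← p─q⊆p f e x∈f─e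
        with g , g∈E , g⊆ ← z≽ (E⊆V H f∈E x∈f) f∈E x∈f z∉f
        -- By the antichain property `g` equals `e`, so `w` would have to lie in `f [ x ↦ z ]`.
        = [ w≢z , w∉f ∘ proj₁ ]′ (∈-↦⁻ (g⊆ (subst (w ∈_) (sym (⊆⇒≡ g∈E e∈E g⊆e)) w∈e)))
        where
        f-x⊆e : ∀ {v} → v ∈ f → v ≢ x → v ∈ e
        f-x⊆e {v} v∈f v≢x = decidable-stable (v ∈? e) λ v∉e →
          v≢x (∣p∣≡1⇒unique _ ∣f─e∣≡1 (x∈p∧x∉q⇒x∈p─q v∈f v∉e) x∈f─e)

        g⊆e : g ⊆ e
        g⊆e = [ (λ { refl → z∈e }) , (λ (v∈f , v≢x) → f-x⊆e v∈f v≢x) ]′ ∘ ∈-↦⁻ ∘ g⊆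

    ∃-splitting-vertex : Nonempty (V H) → ∃[ z ] z ∈ V H ×
      (∀ {e f} → E H e → E H f → z ∈ e → z ∉ f → e - z ⊆ f)
    ∃-splitting-vertex ne with z , z∈V , z≽ ← greatest dominates-total dominates-trans (V H) ne =
      z , z∈V , dominating⇒splits z≽

-- Links of a hypergraph

link : Hypergraph n → Subset n → Subset n → Hypergraph n
link H p W = record
  { V   = W
  ; E   = λ e → E H (p ∪ e) × e ⊆ W
  ; E?  = λ e → E? H (p ∪ e) ×-dec e ⊆? W
  ; E⊆V = proj₂
  }

-- Putting the disjoint prefix `p` back changes neither difference and keeps distinct hyperedges
-- distinct, so the condition is inherited from `H`.
link-1-Sperner : ∀ (H : Hypergraph n) {p W} → (∀ {x} → x ∈ p → x ∉ W) →
                 1-Sperner H → 1-Sperner (link H p W)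
link-1-Sperner H {p} {W} p∩W=∅ sperner {e} {f} (p∪e∈E , e⊆W) (p∪f∈E , f⊆W) e≢f = begin
  ∣ e ─ f ∣ ⊓ ∣ f ─ e ∣
    ≡⟨ cong₂ (λ d d′ → ∣ d ∣ ⊓ ∣ d′ ∣) ([r∪p]─[r∪q]≡p─q (disjoint e⊆W)) ([r∪p]─[r∪q]≡p─q (disjoint f⊆W)) ⟨
  ∣ (p ∪ e) ─ (p ∪ f) ∣ ⊓ ∣ (p ∪ f) ─ (p ∪ e) ∣
    ≡⟨ sperner p∪e∈E p∪f∈E p∪e≢p∪f ⟩
  1 ∎
  where
  open ≡-Reasoning

  disjoint : ∀ {e x} → e ⊆ W → x ∈ p → x ∉ e
  disjoint e⊆W x∈p x∈e = p∩W=∅ x∈p (e⊆W x∈e)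

  p∪e≢p∪f : p ∪ e ≢ p ∪ f
  p∪e≢p∪f eq = e≢f (⊆-antisym (∪-cancelˡ-⊆ (disjoint e⊆W) (⊆-reflexive eq))
                              (∪-cancelˡ-⊆ (disjoint f⊆W) (⊆-reflexive (sym eq))))

1-Sperner-resp-≐ : ∀ (H K : Hypergraph n) → E H ≐ E K → 1-Sperner K → 1-Sperner H
1-Sperner-resp-≐ _ _ (H⊆K , _) sperner e∈E f∈E = sperner (H⊆K e∈E) (H⊆K f∈E)

-- Decomposition at a splitting vertex

SmallerSafeGluing : Hypergraph n → Set₁
SmallerSafeGluing H = ∃[ H₁ ] ∃[ H₂ ]
  (1-Sperner H₁ × 1-Sperner H₂ ×
   (∣ V H₁ ∣ < ∣ V H ∣) × (∣ V H₂ ∣ < ∣ V H ∣) ×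
   IsSafeGluing H₁ H₂ H)

module Decomposition
  (H : Hypergraph n) (sperner : 1-Sperner H) {z : Fin n} (z∈V : z ∈ V H)
  (splits : ∀ {e f} → E H e → E H f → z ∈ e → z ∉ f → e - z ⊆ f)
  where

  InV₁ : Pred (Fin n) _
  InV₁ v = ∃[ e ] (E H e × z ∈ e) × v ∈ e - z

  inV₁? : Decidable InV₁
  inV₁? v = anySubset? λ e → (E? H e ×-dec z ∈? e) ×-dec v ∈? (e - z)

  V₁ V₂ : Subset n
  V₁ = comprehension inV₁?
  V₂ = (V H ─ V₁) - z

  V₁⊆V : V₁ ⊆ V H
  V₁⊆V v∈V₁ with e , (e∈E , _) , v∈e-z ← ∈-comprehension⁻ inV₁? v∈V₁ =
    E⊆V H e∈E (p─q⊆p e ⁅ z ⁆ v∈e-z)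

  V₂⊆V─V₁ : V₂ ⊆ V H ─ V₁
  V₂⊆V─V₁ = p─q⊆p (V H ─ V₁) ⁅ z ⁆

  V₂⊆V : V₂ ⊆ V H
  V₂⊆V = p─q⊆p (V H) V₁ ∘ V₂⊆V─V₁

  z∉V₁ : z ∉ V₁
  z∉V₁ z∈V₁ with e , _ , z∈e-z ← ∈-comprehension⁻ inV₁? z∈V₁ = x∈p-y⇒x≢y e z z∈e-z refl

  z∉V₂ : z ∉ V₂
  z∉V₂ z∈V₂ = x∈p-y⇒x≢y (V H ─ V₁) z z∈V₂ refl

  V₁∩V₂=∅ : x ∈ V₁ → x ∉ V₂
  V₁∩V₂=∅ x∈V₁ x∈V₂ = x∈p─q⇒x∉q (V H) V₁ (V₂⊆V─V₁ x∈V₂) x∈V₁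

  ⁅z⁆∩V₁=∅ : x ∈ ⁅ z ⁆ → x ∉ V₁
  ⁅z⁆∩V₁=∅ x∈⁅z⁆ x∈V₁ with refl ← x∈⁅y⁆⇒x≡y z x∈⁅z⁆ = z∉V₁ x∈V₁

  e-z⊆V₁ : ∀ {e} → E H e → z ∈ e → e - z ⊆ V₁
  e-z⊆V₁ e∈E z∈e v∈e-z = ∈-comprehension⁺ inV₁? (_ , (e∈E , z∈e) , v∈e-z)

  -- Each vertex of `V₁` comes from some hyperedge through `z`, and splitting places it in `f`.
  -- Hyperedges avoiding `z` thus have the form that gluing requires.
  V₁⊆f : ∀ {f} → E H f → z ∉ f → V₁ ⊆ f
  V₁⊆f f∈E z∉f v∈V₁ with _ , (e∈E , z∈e) , v∈e-z ← ∈-comprehension⁻ inV₁? v∈V₁ =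
    splits e∈E f∈E z∈e z∉f v∈e-z

  -- Each link strips the prefix that gluing adds: `⁅ z ⁆` on the first side, `V₁` on the second.
  H₁ H₂ : Hypergraph n
  H₁ = link H ⁅ z ⁆ V₁
  H₂ = link H V₁ V₂

  V-glued : V H ≡ (V₁ ∪ V₂) ∪ ⁅ z ⁆
  V-glued = ⊆-antisym V⊆ (∪-⊆ (∪-⊆ V₁⊆V V₂⊆V) λ x∈⁅z⁆ → subst (_∈ V H) (sym (x∈⁅y⁆⇒x≡y z x∈⁅z⁆)) z∈V)
    where
    V⊆ : V H ⊆ (V₁ ∪ V₂) ∪ ⁅ z ⁆
    V⊆ {v} v∈V with v ≟ z | v ∈? V₁
    ... | yes refl | _       = x∈p∪q⁺ (inj₂ (x∈⁅x⁆ z))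
    ... | no _    | yes v∈V₁ = x∈p∪q⁺ (inj₁ (x∈p∪q⁺ (inj₁ v∈V₁)))
    ... | no v≢z  | no  v∉V₁ =
      x∈p∪q⁺ (inj₁ (x∈p∪q⁺ (inj₂ (x∈p∧x≢y⇒x∈p-y (x∈p∧x∉q⇒x∈p─q v∈V v∉V₁) v≢z))))

  E-glued : E H ≐ E (glue z H₁ H₂)
  E-glued = unglue , λ
    { (inj₁ (_ , (z∪e∈E , _) , refl)) → z∪e∈E
    ; (inj₂ (_ , (V₁∪e∈E , _) , refl)) → V₁∪e∈E
    }
    where
    unglue : ∀ {g} → E H g → E (glue z H₁ H₂) g
    unglue {g} g∈E with z ∈? g
    ... | yes z∈g = inj₁ (g - z , (subst (E H) (sym eq) g∈E , e-z⊆V₁ g∈E z∈g) , sym eq)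
      where
      eq : ⁅ z ⁆ ∪ (g - z) ≡ g
      eq = p⊆q⇒p∪[q─p]≡q λ x∈⁅z⁆ → subst (_∈ g) (sym (x∈⁅y⁆⇒x≡y z x∈⁅z⁆)) z∈g
    ... | no  z∉g = inj₂ (g ─ V₁ , (subst (E H) (sym eq) g∈E , g─V₁⊆V₂) , sym eq)
      where
      eq : V₁ ∪ (g ─ V₁) ≡ g
      eq = p⊆q⇒p∪[q─p]≡q (V₁⊆f g∈E z∉g)

      g─V₁⊆V₂ : g ─ V₁ ⊆ V₂
      g─V₁⊆V₂ x∈ = x∈p∧x≢y⇒x∈p-y (x∈p∧x∉q⇒x∈p─q (E⊆V H g∈E x∈g) (x∈p─q⇒x∉q g V₁ x∈)) λ { refl → z∉g x∈g }
        where x∈g = p─q⊆p g V₁ x∈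

  isGluing : IsGluing z H₁ H₂ H
  isGluing = record
    { disjoint = λ (_ , x∈V₁∩V₂) → let x∈V₁ , x∈V₂ = x∈p∩q⁻ V₁ V₂ x∈V₁∩V₂ in V₁∩V₂=∅ x∈V₁ x∈V₂
    ; z-new    = [ z∉V₁ , z∉V₂ ]′ ∘ x∈p∪q⁻ V₁ V₂
    ; glued    = V-glued , E-glued
    }

  smallerSafeGluing : SmallerSafeGluing H
  smallerSafeGluing = H₁ , H₂
    , link-1-Sperner H ⁅z⁆∩V₁=∅ sperner
    , link-1-Sperner H V₁∩V₂=∅ sperner
    -- Both sides are strictly smaller because each omits `z`.
    , p⊂q⇒∣p∣<∣q∣ (V₁⊆V , z , z∈V , z∉V₁)
    , p⊂q⇒∣p∣<∣q∣ (V₂⊆V , z , z∈V , z∉V₂)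
    , z , isGluing , 1-Sperner-resp-≐ (glue z H₁ H₂) H (proj₂ E-glued , proj₁ E-glued) sperner

-- Vertexless hypergraphs and the two equivalences

module _ (H : Hypergraph n) where

  edge-⊥ : NoVertices H → ∀ {e} → E H e → e ≡ ⊥
  edge-⊥ noV e∈E = Empty-unique λ (_ , x∈e) → noV (_ , E⊆V H e∈E x∈e)

  noVertices⇒1-Sperner : NoVertices H → 1-Sperner H
  noVertices⇒1-Sperner noV e∈E f∈E e≢f =
    contradiction (trans (edge-⊥ noV e∈E) (sym (edge-⊥ noV f∈E))) e≢f

  1-Sperner⇒decomposable : 1-Sperner H → NoVertices H ⊎ SmallerSafeGluing H
  1-Sperner⇒decomposable sperner with nonempty? (V H)
  ... | no noV = inj₁ noV
  ... | yes ne with _ , z∈V , splits ← ∃-splitting-vertex H sperner ne =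
    inj₂ (Decomposition.smallerSafeGluing H sperner z∈V splits)

  decomposable⇒1-Sperner : NoVertices H ⊎ SmallerSafeGluing H → 1-Sperner H
  decomposable⇒1-Sperner (inj₁ noV) = noVertices⇒1-Sperner noV
  -- Safety is the 1-Sperner property of the gluing, which has the same hyperedges as `H`.
  decomposable⇒1-Sperner (inj₂ (H₁ , H₂ , _ , _ , _ , _ , z , gluing , safe)) =
    1-Sperner-resp-≐ H (glue z H₁ H₂) (proj₂ (IsGluing.glued gluing)) safe

  noVertices⇒trivial : NoVertices H → (H ≋ ⟨∅,∅⟩) ⊎ (H ≋ ⟨∅,｛∅｝⟩)
  -- Only `⊥` can be a hyperedge, so a single membership test separates the two hypergraphs.
  noVertices⇒trivial noV with E? H ⊥
  ... | yes ⊥∈E = inj₂ (Empty-unique noV , (λ e∈E → sym (edge-⊥ noV e∈E)) , λ { refl → ⊥∈E })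
  ... | no  ⊥∉E = inj₁ (Empty-unique noV , (λ e∈E → ⊥∉E (subst (E H) (edge-⊥ noV e∈E) e∈E)) , λ ())

  trivial⇒noVertices : (H ≋ ⟨∅,∅⟩) ⊎ (H ≋ ⟨∅,｛∅｝⟩) → NoVertices H
  trivial⇒noVertices H≋ (_ , x∈V) = ∉⊥ (subst (_ ∈_) ([ proj₁ , proj₁ ]′ H≋) x∈V)

theorem10 : ∀ (n : ℕ) (H : Hypergraph n) →
    (1-Sperner H ⇔
    (NoVertices H ⊎
    (∃[ H₁ ] ∃[ H₂ ]
    (1-Sperner H₁ × 1-Sperner H₂ ×
    (∣ V H₁ ∣ < ∣ V H ∣) × (∣ V H₂ ∣ < ∣ V H ∣) ×
    IsSafeGluing H₁ H₂ H))))
    × (NoVertices H ⇔ ((H ≋ ⟨∅,∅⟩) ⊎ (H ≋ ⟨∅,｛∅｝⟩)))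
theorem10 n H =
    mk⇔ (1-Sperner⇒decomposable H) (decomposable⇒1-Sperner H)
  , mk⇔ (noVertices⇒trivial H) (trivial⇒noVertices H)
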